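{- The string $0212$ has sorting distance $3$. Every other normalized fully ternary string $s$ of length $n$ ending in the symbol $2$ has $d_{\rm s}(s)=n-2$ if $s$ is bad and $d_{\rm s}(s)=n-3$ if $s$ is good. A normalized fully ternary string $s$ ending in $0$ or $1$ has the same sorting distance as the string $s2$ ($s$ followed by the symbol $2$).
   Context: Strings are finite words over $\{0,1,2,\dots\}$. A string is \emph{normalized} if no two adjacent symbols are equal; the \emph{normalization} of a string replaces every maximal run of identical symbols by a single copy. A string is \emph{fully $k$-ary} if the set of symbols occurring in it is exactly $\{0,\dots,k-1\}$; fully ternary means fully $3$-ary. For a normalized string $s=s_1\cdots s_n$ and $1\le i\le n$, the flip $f^{(i)}(s)$ is the normalization of $s_i\cdots s_1 s_{i+1}\cdots s_n$. The sorting distance $d_{\rm s}(s)$ of a normalized fully ternary string is the minimum number of flips needed to transform $s$ into $012$. Regular-expression notation: $w^i$ is $i$ repetitions of $w$, $w^*$ is zero or more, $w^+$ one or more, $w^{\ge 2}$ two or more repetitions; $\{a,b\}$ denotes a single symbol that is either $a$ or $b$ (chosen independently at each occurrence). A normalized fully ternary string ending in $2$ is \emph{bad} (for sorting; no relabelling allowed) if it is of one of the following types: (I) $0(12)^{\ge 2}$; (II) $(\{0,1\}2)^+$ or $2(\{0,1\}2)^+$; (III) $(\{1,2\}0)^+2$ or $0(\{1,2\}0)^+2$; (IV) $(\{1,2\}0)^+12$ or $(0\{1,2\})^+012$, in either case containing at least two occurrences of $2$; (V) $(01)^*0212$ or $(10)^+212$; (VI) $1(20)^+1(20)^*2$ or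 $0(21)^+0(21)^*2$; (VII) $1(02)^+1(02)^+$; (VIII) $1(02)^+12$; (IX) one of the following 77 strings: 210212, 021012, 212012, 120102, 201202, 0210202, 1021202, 0212012, 2120102, 0102102, 1212012, 2010212, 0120212, 1201012, 1201212, 2012012, 10210212, 21021212, 02102012, 02101212, 10212012, 02121012, 02120102, 10102102, 02010212, 21202012, 21201012, 21201202, 20210212, 01021202, 01020212, 20212012, 12120102, 12010212, 12010202, 20120102, 12012012, 021021202, 102120102, 102010212, 021202012, 021201012, 020210212, 101020212, 020212012, 212010202, 212012012, 010210212, 010210202, 010212012, 202010212, 121202012, 121201202, 201021202, 120212012, 012021212, 120102012, 201202012, 120120212, 201201012, 0210212012, 1021202012, 1021201012, 1020210212, 1010210202, 0202010212, 2120202012, 2120102012, 2021021212, 2010212012, 1201021202, 1201202012, 10202010212, 02120102012, 02021021212, 21201202012, 12120202012. All other normalized fully ternary strings ending in $2$ are \emph{good}. (In particular $0212$ is bad, of type V.) -}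

module Defs where

open import Data.Char.Base as Char using ()
open import Data.List.Base
  using (List; []; _∷_; _++_; derun; drop; filter; length; map; reverse; take)
open import Data.List.Membership.Propositional renaming (_∈_ to _∈ˡ_) using ()
open import Data.List.Relation.Unary.Linked using (Linked)
open import Data.Nat.Base using (ℕ; zero; suc; _∸_; _≤_; _<_)
open import Data.Nat.Properties using (_≟_; ≤-decTotalOrder)
open import Data.String.Base using (String; toList)
open import Function.Base using (_∘_)
open import Function.Bundles using (_⇔_)
open import Relation.Binary.Bundles using (DecTotalOrder)
open import Relation.Binary.PropositionalEquality.Core using (_≢_)
open import Relation.Nullary.Negation.Core using (¬_)

open import Text.Regex (DecTotalOrder.decPoset ≤-decTotalOrder)
  using (Exp; singleton; _∈_; _∣_; _∙_; _⋆; _+)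

Word : Set
Word = List ℕ

Normalized : Word → Set
Normalized = Linked _≢_

normalize : Word → Word
normalize = derun _≟_

Fully_-ary : ℕ → Word → Set
Fully k -ary s = ∀ x → x ∈ˡ s ⇔ x < k

flip : ℕ → Word → Word
flip i s = normalize (reverse (take i s) ++ drop i s)

-- s ↝[ m ] t : some sequence of exactly m flips transforms s into t.
infix 4 _↝[_]_
data _↝[_]_ : Word → ℕ → Word → Set where
  done : ∀ {s} → s ↝[ zero ] s
  step : ∀ {s t m} i → 1 ≤ i → i ≤ length s → flip i s ↝[ m ] t → s ↝[ suc m ] t

-- SortingDistance s d says that d is the sorting distance of s.  It is a
-- relation, so asserting it includes that s can be sorted at all.
record SortingDistance (s : Word) (d : ℕ) : Set where
  field
    attained : s ↝[ d ] 0 ∷ 1 ∷ 2 ∷ []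
    minimal  : ∀ {m} → s ↝[ m ] 0 ∷ 1 ∷ 2 ∷ [] → d ≤ m

-- Decimal digits are the consecutive characters with codes 48 to 57.  Only
-- meaningful on strings of digits.
digits : String → Word
digits = map (λ c → Char.toℕ c ∸ 48) ∘ toList

exceptional : List Word
exceptional = map digits (
  "210212" ∷ "021012" ∷ "212012" ∷ "120102" ∷ "201202" ∷ "0210202" ∷
  "1021202" ∷ "0212012" ∷ "2120102" ∷ "0102102" ∷ "1212012" ∷ "2010212" ∷
  "0120212" ∷ "1201012" ∷ "1201212" ∷ "2012012" ∷ "10210212" ∷ "21021212" ∷
  "02102012" ∷ "02101212" ∷ "10212012" ∷ "02121012" ∷ "02120102" ∷ "10102102" ∷
  "02010212" ∷ "21202012" ∷ "21201012" ∷ "21201202" ∷ "20210212" ∷ "01021202" ∷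
  "01020212" ∷ "20212012" ∷ "12120102" ∷ "12010212" ∷ "12010202" ∷ "20120102" ∷
  "12012012" ∷ "021021202" ∷ "102120102" ∷ "102010212" ∷ "021202012" ∷ "021201012" ∷
  "020210212" ∷ "101020212" ∷ "020212012" ∷ "212010202" ∷ "212012012" ∷ "010210212" ∷
  "010210202" ∷ "010212012" ∷ "202010212" ∷ "121202012" ∷ "121201202" ∷ "201021202" ∷
  "120212012" ∷ "012021212" ∷ "120102012" ∷ "201202012" ∷ "120120212" ∷ "201201012" ∷
  "0210212012" ∷ "1021202012" ∷ "1021201012" ∷ "1020210212" ∷ "1010210202" ∷ "0202010212" ∷
  "2120202012" ∷ "2120102012" ∷ "2021021212" ∷ "2010212012" ∷ "1201021202" ∷ "1201202012" ∷
  "10202010212" ∷ "02120102012" ∷ "02021021212" ∷ "21201202012" ∷ "12120202012" ∷ [])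

`0 `1 `2 : Exp
`0 = singleton 0
`1 = singleton 1
`2 = singleton 2

-- Bad and Good are intended for normalized fully ternary words ending in 2;
-- on other words they carry no meaning.  The postfix operators _⋆ and _+
-- mean zero or more and one or more repetitions respectively, and bind
-- more tightly than _∙_.
data Bad (s : Word) : Set where
  I    : s ∈ `0 ∙ (`1 ∙ `2) ∙ (`1 ∙ `2) + → Bad s
  II   : s ∈ ((`0 ∣ `1) ∙ `2) + ∣ `2 ∙ ((`0 ∣ `1) ∙ `2) + → Bad s
  III  : s ∈ ((`1 ∣ `2) ∙ `0) + ∙ `2 ∣ `0 ∙ ((`1 ∣ `2) ∙ `0) + ∙ `2 → Bad s
  IV   : s ∈ ((`1 ∣ `2) ∙ `0) + ∙ `1 ∙ `2 ∣ (`0 ∙ (`1 ∣ `2)) + ∙ `0 ∙ `1 ∙ `2 →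
         2 ≤ length (filter (_≟ 2) s) → Bad s
  V    : s ∈ (`0 ∙ `1) ⋆ ∙ `0 ∙ `2 ∙ `1 ∙ `2 ∣ (`1 ∙ `0) + ∙ `2 ∙ `1 ∙ `2 → Bad s
  VI   : s ∈ `1 ∙ (`2 ∙ `0) + ∙ `1 ∙ (`2 ∙ `0) ⋆ ∙ `2
           ∣ `0 ∙ (`2 ∙ `1) + ∙ `0 ∙ (`2 ∙ `1) ⋆ ∙ `2 → Bad s
  VII  : s ∈ `1 ∙ (`0 ∙ `2) + ∙ `1 ∙ (`0 ∙ `2) + → Bad s
  VIII : s ∈ `1 ∙ (`0 ∙ `2) + ∙ `1 ∙ `2 → Bad s
  IX   : s ∈ˡ exceptional → Bad s

Good : Word → Set
Good s = ¬ Bad s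

{-# OPTIONS --safe #-}
-- A flip of a normalized word shortens it by at most one letter, and it does so
-- exactly when it turns c x c w into x^R c w.  The theorem thus follows from
--   (A) a shortening flip of a bad word gives a bad word;
--   (B) a good word of length at least 6 has a shortening flip to a good word;
--   (C) a bad word of length at least 6 has a shortening flip, or else the
--       exchange of its first two letters gives a good word;
-- together with a search through the words of length at most 5.  The bad words
-- form a regular language, so (A)-(C) can be checked with finitely many states:
-- reading a word u from left to right, it is enough to know the state of u in the
-- automaton of bad words, the set of states of the words obtained from u by a
-- shortening flip, and the transformation of the states by u^R, which provides
-- the new members of this set.  The three facts are then properties of the
-- reachable combinations (a few hundred), found by a graph search.
--
-- For a word s not ending in 2, a flip of s2 that keeps the last letter is a flip
-- of s followed by 2, up to normalization; (A)-(C) never flip the whole word.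
module Submission where

open import Defs
open import Data.List.Base using ([]; _∷_; _∷ʳ_; last; length)
open import Data.Maybe.Base using (just)
open import Data.Nat.Base using (_∸_)
open import Data.Product.Base using (_×_; ∃-syntax)
open import Data.Sum.Base using (_⊎_)
open import Relation.Binary.PropositionalEquality.Core using (_≡_; _≢_)

open import Data.Bool.Base using (true; if_then_else_)
open import Data.Bool.ListAction using (all)
open import Data.List.Base using
  ( List; _++_; _ʳ++_; cartesianProductWith; concatMap; deduplicate; derun; drop
  ; filter; foldl; map; reverse; take; upTo)
import Data.List.Membership.DecPropositional as DecMembership
open import Data.List.Membership.Propositional using (find; lose) renaming (_∈_ to _∈ˡ_)
open import Data.List.Membership.Propositional.Properties
open import Data.List.Properties as List using
  (++-assoc; filter-reject; length-++; length-take; take++drop≡id; ʳ++-defn; ∷ʳ-injectiveˡ)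
open import Data.List.Relation.Binary.Permutation.Propositional.Properties using
  (++↭ʳ++; ↭-length; All-resp-↭; ∈-resp-↭)
open import Data.List.Relation.Binary.Pointwise using (Pointwise-≡⇒≡; ≡⇒Pointwise-≡)
open import Data.List.Relation.Ternary.Appending using ([]++_; _∷_)
open import Data.List.Relation.Unary.All as All using (All; []; _∷_)
import Data.List.Relation.Unary.All.Properties as All
open import Data.List.Relation.Unary.Any as Any using (Any; here; there)
import Data.List.Relation.Unary.Any.Properties as Any
open import Data.List.Relation.Unary.Linked as Linked using (Linked; []; [-]; _∷_; linked?)
open import Data.Maybe.Properties as Maybe using (just-injective)
open import Data.Nat.Base
open import Data.Nat.Properties
open import Data.Product.Base using (_,_; proj₁; proj₂; uncurry)
open import Data.Product.Properties using (,-injective)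
open import Data.Sum.Base as Sum using (inj₁; inj₂)
open import Function.Base using (_∘_)
open import Function.Bundles using (Equivalence)
open import Relation.Binary.Bundles using (DecPoset; DecTotalOrder)
open import Relation.Binary.Definitions using (DecidableEquality)
open import Relation.Binary.PropositionalEquality.Core
open import Relation.Nullary.Decidable using
  ( Dec; yes; no; does; fromWitness; isYes; map′; toWitness; T?; ¬?
  ; _×-dec_; _→-dec_; _⊎-dec_)
open import Relation.Nullary.Negation.Core

-- Ternary words and the transition table

ℕ-decPoset : DecPoset _ _ _
ℕ-decPoset = DecTotalOrder.decPoset ≤-decTotalOrder

open import Text.Regex ℕ-decPoset using
  (Exp; Range; _∈_; _∣_; _∙_; _⋆; _+; prod; star; sum)
import Text.Regex.Base (DecPoset.preorder ℕ-decPoset) as Regex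
open import Text.Regex.Properties ℕ-decPoset using ([]∈?_; _∈?[_]; _∈?[^_])
open import Text.Regex.SmartConstructors (DecPoset.preorder ℕ-decPoset) using (∙-sound; ∙-complete)

infix 4 _∈ˡ?_
_∈ˡ?_ = DecMembership._∈?_ _≟_

-- Checking `refl` against `does P? ≡ true` evaluates only a boolean; all large finite checks below
-- are discharged in this way.
witness : ∀ {P : Set} (P? : Dec P) → does P? ≡ true → P
witness (yes p) _ = p

letters : List ℕ
letters = 0 ∷ 1 ∷ 2 ∷ []

Letters : Word → Set
Letters = All (_∈ˡ letters)

-- The default 0 is the sink of the automaton below, so letters without a row and states beyond a
-- row lead to rejection.
nth : List ℕ → ℕ → ℕ
nth []       n       = 0
nth (x ∷ xs) zero    = x
nth (x ∷ xs) (suc n) = nth xs n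

-- The minimal automaton of the bad words, with start state 1 and sink 0: entry
-- q of row a is the state reached from q by the letter a.
row : ℕ → List ℕ
row 0 =
  0 ∷ 2 ∷ 0 ∷ 7 ∷ 9 ∷ 11 ∷ 13 ∷ 0 ∷ 17 ∷ 0 ∷ 21 ∷ 0 ∷ 21 ∷ 0 ∷ 27 ∷ 29 ∷ 30 ∷ 0 ∷ 0 ∷
  35 ∷ 37 ∷ 0 ∷ 40 ∷ 42 ∷ 43 ∷ 0 ∷ 43 ∷ 0 ∷ 49 ∷ 0 ∷ 0 ∷ 53 ∷ 54 ∷ 56 ∷ 58 ∷ 0 ∷ 61 ∷
  0 ∷ 21 ∷ 0 ∷ 0 ∷ 0 ∷ 0 ∷ 0 ∷ 68 ∷ 0 ∷ 0 ∷ 0 ∷ 71 ∷ 0 ∷ 74 ∷ 43 ∷ 77 ∷ 0 ∷ 0 ∷ 82 ∷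
  0 ∷ 0 ∷ 0 ∷ 86 ∷ 86 ∷ 0 ∷ 90 ∷ 91 ∷ 92 ∷ 94 ∷ 41 ∷ 86 ∷ 0 ∷ 71 ∷ 0 ∷ 0 ∷ 0 ∷ 97 ∷
  0 ∷ 41 ∷ 99 ∷ 0 ∷ 53 ∷ 83 ∷ 0 ∷ 71 ∷ 0 ∷ 0 ∷ 56 ∷ 80 ∷ 0 ∷ 0 ∷ 71 ∷ 105 ∷ 0 ∷ 0 ∷
  0 ∷ 97 ∷ 0 ∷ 80 ∷ 71 ∷ 0 ∷ 25 ∷ 0 ∷ 106 ∷ 108 ∷ 83 ∷ 80 ∷ 86 ∷ 0 ∷ 0 ∷ 83 ∷ 0 ∷ []
row 1 =
  0 ∷ 3 ∷ 5 ∷ 0 ∷ 10 ∷ 0 ∷ 14 ∷ 15 ∷ 18 ∷ 19 ∷ 0 ∷ 23 ∷ 25 ∷ 26 ∷ 0 ∷ 0 ∷ 31 ∷ 32 ∷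
  0 ∷ 0 ∷ 38 ∷ 0 ∷ 41 ∷ 0 ∷ 44 ∷ 0 ∷ 0 ∷ 47 ∷ 50 ∷ 23 ∷ 26 ∷ 0 ∷ 0 ∷ 57 ∷ 41 ∷ 59 ∷
  0 ∷ 26 ∷ 0 ∷ 47 ∷ 64 ∷ 0 ∷ 23 ∷ 59 ∷ 0 ∷ 25 ∷ 0 ∷ 0 ∷ 72 ∷ 73 ∷ 0 ∷ 76 ∷ 78 ∷ 0 ∷
  80 ∷ 80 ∷ 83 ∷ 0 ∷ 85 ∷ 0 ∷ 87 ∷ 88 ∷ 41 ∷ 41 ∷ 0 ∷ 41 ∷ 41 ∷ 80 ∷ 0 ∷ 0 ∷ 80 ∷
  80 ∷ 0 ∷ 0 ∷ 80 ∷ 98 ∷ 0 ∷ 26 ∷ 0 ∷ 80 ∷ 0 ∷ 99 ∷ 80 ∷ 0 ∷ 41 ∷ 0 ∷ 59 ∷ 0 ∷ 0 ∷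
  0 ∷ 59 ∷ 80 ∷ 80 ∷ 0 ∷ 80 ∷ 80 ∷ 25 ∷ 80 ∷ 0 ∷ 0 ∷ 107 ∷ 80 ∷ 0 ∷ 0 ∷ 0 ∷ 80 ∷ 59 ∷
  0 ∷ 80 ∷ []
row 2 =
  0 ∷ 4 ∷ 6 ∷ 8 ∷ 0 ∷ 12 ∷ 0 ∷ 16 ∷ 0 ∷ 20 ∷ 22 ∷ 24 ∷ 0 ∷ 20 ∷ 28 ∷ 0 ∷ 0 ∷ 33 ∷
  34 ∷ 36 ∷ 0 ∷ 39 ∷ 0 ∷ 0 ∷ 0 ∷ 45 ∷ 46 ∷ 48 ∷ 0 ∷ 51 ∷ 52 ∷ 36 ∷ 55 ∷ 0 ∷ 0 ∷ 60 ∷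
  0 ∷ 62 ∷ 63 ∷ 0 ∷ 65 ∷ 66 ∷ 67 ∷ 67 ∷ 69 ∷ 0 ∷ 0 ∷ 70 ∷ 0 ∷ 63 ∷ 75 ∷ 0 ∷ 0 ∷ 79 ∷
  81 ∷ 0 ∷ 84 ∷ 63 ∷ 65 ∷ 46 ∷ 0 ∷ 89 ∷ 0 ∷ 0 ∷ 93 ∷ 0 ∷ 0 ∷ 0 ∷ 95 ∷ 0 ∷ 0 ∷ 46 ∷
  96 ∷ 46 ∷ 45 ∷ 0 ∷ 46 ∷ 100 ∷ 46 ∷ 0 ∷ 46 ∷ 0 ∷ 101 ∷ 102 ∷ 0 ∷ 103 ∷ 104 ∷ 69 ∷
  46 ∷ 0 ∷ 62 ∷ 66 ∷ 69 ∷ 0 ∷ 63 ∷ 0 ∷ 0 ∷ 89 ∷ 75 ∷ 103 ∷ 0 ∷ 0 ∷ 0 ∷ 0 ∷ 0 ∷ 0 ∷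
  100 ∷ 46 ∷ 102 ∷ []
row _ = []

accepting : List ℕ
accepting =
  6 ∷ 8 ∷ 16 ∷ 20 ∷ 22 ∷ 24 ∷ 28 ∷ 33 ∷ 34 ∷ 36 ∷ 45 ∷ 46 ∷ 48 ∷ 51 ∷ 52 ∷ 55 ∷ 60 ∷
  62 ∷ 63 ∷ 65 ∷ 66 ∷ 67 ∷ 69 ∷ 70 ∷ 75 ∷ 79 ∷ 81 ∷ 84 ∷ 89 ∷ 93 ∷ 95 ∷ 96 ∷ 100 ∷
  101 ∷ 102 ∷ 103 ∷ 104 ∷ []

δ : ℕ → ℕ → ℕ
δ q a = nth (row a) q

run : ℕ → Word → ℕ
run = foldl δ

Accepting : ℕ → Set
Accepting q = q ∈ˡ accepting

accepting? : ∀ q → Dec (Accepting q)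
accepting? q = q ∈ˡ? accepting

Accepted : Word → Set
Accepted w = Accepting (run 1 w)

accepted? : ∀ w → Dec (Accepted w)
accepted? w = accepting? (run 1 w)

-- Evaluating All.all? keeps the evidence for every element of the list in
-- memory; here the decision is a plain boolean.
all? : ∀ {A : Set} {P : A → Set} → (∀ x → Dec (P x)) → ∀ xs → Dec (All P xs)
all? P? xs = map′ (All.map (λ {x} → toWitness {a? = P? x}) ∘ All.all⁺ (isYes ∘ P?) xs)
                  (All.all⁻ (isYes ∘ P?) ∘ All.map (λ {x} → fromWitness {a? = P? x}))
                  (T? (all (isYes ∘ P?) xs))

-- Certified search of finite state graphs

module Exploration {X : Set} (_≟ₓ_ : DecidableEquality X)
                   (starts : List X) (successors : X → List X)
                   {OK : X → Set} (ok? : ∀ x → Dec (OK x)) where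

  open DecMembership _≟ₓ_ using (_∈?_)

  -- Nothing is proved about the search itself. Its output is a candidate for a closed set, which
  -- `invariant?` verifies independently.
  explore : ℕ → List X → List X → List X
  explore zero       seen _          = seen
  explore (suc fuel) seen []         = seen
  explore (suc fuel) seen (x ∷ todo) =
    if does (x ∈? seen) then explore fuel seen todo
                        else explore fuel (x ∷ seen) (successors x ++ todo)

  -- The fuel only has to exceed the number of transitions.
  states : List X
  states = explore 2000 [] starts

  Invariant : List X → Set
  Invariant xs = All (_∈ˡ xs) starts × All (λ x → All (_∈ˡ xs) (successors x)) xs × All OK xs

  invariant? : ∀ xs → Dec (Invariant xs)
  invariant? xs = all? (_∈? xs) starts
            ×-dec all? (λ x → all? (_∈? xs) (successors x)) xs
            ×-dec all? ok? xs

×-≟ : ∀ {A B : Set} → DecidableEquality A → DecidableEquality B → DecidableEquality (A × B)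
×-≟ _≟₁_ _≟₂_ (a , b) (c , d) = map′ (uncurry (cong₂ _,_)) ,-injective (a ≟₁ c ×-dec b ≟₂ d)

-- Regular expressions and the automaton of bad words

_≟ᴿ_ : DecidableEquality Range
Regex.[ a ]   ≟ᴿ Regex.[ b ]   = map′ (cong Regex.[_]) (λ { refl → refl }) (a ≟ b)
Regex.[ _ ]   ≟ᴿ (_ Regex.─ _) = no λ ()
(_ Regex.─ _) ≟ᴿ Regex.[ _ ]   = no λ ()
(a Regex.─ b) ≟ᴿ (c Regex.─ d) =
  map′ (uncurry (cong₂ Regex._─_)) (λ { refl → refl , refl }) (a ≟ c ×-dec b ≟ d)

-- Comparing constructors first leaves only the six diagonal cases for `_≟ᴱ_`.
constructorOf : Exp → ℕ
constructorOf Regex.ε       = 0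
constructorOf Regex.[ _ ]   = 1
constructorOf Regex.[^ _ ]  = 2
constructorOf (_ Regex.∣ _) = 3
constructorOf (_ Regex.∙ _) = 4
constructorOf (_ Regex.⋆)   = 5

_≟ᴱ_ : DecidableEquality Exp
≟ᴱ-same : ∀ e f → constructorOf e ≡ constructorOf f → Dec (e ≡ f)

e ≟ᴱ f with constructorOf e ≟ constructorOf f
... | yes p = ≟ᴱ-same e f p
... | no ¬p = no (¬p ∘ cong constructorOf)

≟ᴱ-same Regex.ε       Regex.ε       refl = yes refl
≟ᴱ-same Regex.[ rs ]  Regex.[ ss ]  refl =
  map′ (cong Regex.[_]) (λ { refl → refl }) (List.≡-dec _≟ᴿ_ rs ss)
≟ᴱ-same Regex.[^ rs ] Regex.[^ ss ] refl =
  map′ (cong Regex.[^_]) (λ { refl → refl }) (List.≡-dec _≟ᴿ_ rs ss)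
≟ᴱ-same (e Regex.∣ f) (g Regex.∣ h) refl =
  map′ (uncurry (cong₂ Regex._∣_)) (λ { refl → refl , refl }) ((e ≟ᴱ g) ×-dec (f ≟ᴱ h))
≟ᴱ-same (e Regex.∙ f) (g Regex.∙ h) refl =
  map′ (uncurry (cong₂ Regex._∙_)) (λ { refl → refl , refl }) ((e ≟ᴱ g) ×-dec (f ≟ᴱ h))
≟ᴱ-same (e Regex.⋆)   (f Regex.⋆)   refl = map′ (cong Regex._⋆) (λ { refl → refl }) (e ≟ᴱ f)

guard : ∀ {P A : Set} → Dec P → List A → List A
guard P? xs = if does P? then xs else []

guard⁻ : ∀ {P A : Set} {Q : A → Set} {xs} (P? : Dec P) → Any Q (guard P? xs) → P × Any Q xs
guard⁻ (yes p) q = p , q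

guard⁺ : ∀ {P A : Set} {Q : A → Set} {xs} (P? : Dec P) → P → Any Q xs → Any Q (guard P? xs)
guard⁺ (yes _) _ q = q
guard⁺ (no ¬p) p _ = contradiction p ¬p

-- Antimirov's partial derivatives: unlike Brzozowski's, the derivatives of an
-- expression form a finite set without any rewriting of expressions.
pderiv : ℕ → Exp → List Exp
pderiv a Regex.ε       = []
pderiv a Regex.[ rs ]  = guard ((a ∷ []) ∈?[ rs ]) (Regex.ε ∷ [])
pderiv a Regex.[^ rs ] = guard ((a ∷ []) ∈?[^ rs ]) (Regex.ε ∷ [])
pderiv a (e Regex.∣ f) = pderiv a e ++ pderiv a f
pderiv a (e Regex.∙ f) = map (_∙ f) (pderiv a e) ++ guard ([]∈? e) (pderiv a f)
pderiv a (e Regex.⋆)   = map (_∙ (e Regex.⋆)) (pderiv a e)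

pderiv-sound  : ∀ {a w} e → Any (w ∈_) (pderiv a e) → (a ∷ w) ∈ e
pderiv-sound∙ : ∀ {a w} e f → Any (w ∈_) (map (_∙ f) (pderiv a e)) → (a ∷ w) ∈ (e Regex.∙ f)

pderiv-sound {a} Regex.[ rs ] p with guard⁻ ((a ∷ []) ∈?[ rs ]) p
... | q , here Regex.ε = q
pderiv-sound {a} Regex.[^ rs ] p with guard⁻ ((a ∷ []) ∈?[^ rs ]) p
... | q , here Regex.ε = q
pderiv-sound {a} (e Regex.∣ f) p =
  sum (Sum.map (pderiv-sound e) (pderiv-sound f) (Any.++⁻ (pderiv a e) p))
pderiv-sound {a} (e Regex.∙ f) p with Any.++⁻ (map (_∙ f) (pderiv a e)) p
... | inj₁ q = pderiv-sound∙ e f q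
... | inj₂ q with guard⁻ ([]∈? e) q
...   | ε∈e , r = prod ([]++ ≡⇒Pointwise-≡ refl) ε∈e (pderiv-sound f r)
pderiv-sound (e Regex.⋆) p = star (sum (inj₂ (pderiv-sound∙ e (e Regex.⋆) p)))

pderiv-sound∙ e f p with find (Any.map⁻ p)
-- The smart constructor `_∙_` may simplify the product, so `∙-sound` is needed to recover the two
-- factors.
... | d , d∈ , q with ∙-sound d f q
...   | prod app u∈d v∈f = prod (refl ∷ app) (pderiv-sound e (lose d∈ u∈d)) v∈f

pderiv-complete : ∀ {a w u} e → u ∈ e → u ≡ a ∷ w → Any (w ∈_) (pderiv a e)
pderiv-complete {a} Regex.[ rs ] p@(Regex.[ _ ]) refl = guard⁺ ((a ∷ []) ∈?[ rs ]) p (here Regex.ε)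
pderiv-complete {a} Regex.[^ rs ] p@(Regex.[^ _ ]) refl = guard⁺ ((a ∷ []) ∈?[^ rs ]) p (here Regex.ε)
pderiv-complete {a} (e Regex.∣ f) (sum (inj₁ p)) eq = Any.++⁺ˡ (pderiv-complete e p eq)
pderiv-complete {a} (e Regex.∣ f) (sum (inj₂ p)) eq = Any.++⁺ʳ (pderiv a e) (pderiv-complete f p eq)
pderiv-complete {a} (e Regex.∙ f) (prod ([]++ app) p q) eq =
  Any.++⁺ʳ (map (_∙ f) (pderiv a e))
    (guard⁺ ([]∈? e) p (pderiv-complete f q (trans (Pointwise-≡⇒≡ app) eq)))
pderiv-complete {a} (e Regex.∙ f) (prod (refl ∷ app) p q) refl =
  Any.++⁺ˡ (Any.map⁺ (Any.map (λ {d} u∈d → ∙-complete d f (prod app u∈d q)) (pderiv-complete e p refl)))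
pderiv-complete (e Regex.⋆) (star (sum (inj₁ Regex.ε))) ()
-- An empty first iteration contributes no letter and is skipped; the recursion is on the match of
-- the remaining iterations.
pderiv-complete (e Regex.⋆) (star (sum (inj₂ (prod ([]++ app) p q)))) eq =
  pderiv-complete (e Regex.⋆) q (trans (Pointwise-≡⇒≡ app) eq)
pderiv-complete (e Regex.⋆) (star (sum (inj₂ (prod (refl ∷ app) p q)))) refl =
  Any.map⁺ (Any.map (λ {d} u∈d → ∙-complete d (e Regex.⋆) (prod app u∈d q)) (pderiv-complete e p refl))

-- An item (k , e) stands for the words matching e with at least k twos.
Item : Set
Item = ℕ × Exp

twos : Word → ℕ
twos w = length (filter (_≟ 2) w)

Matches : Word → Item → Set
Matches w (k , e) = k ≤ twos w × w ∈ e

owed : ∀ {P : Set} → Dec P → ℕ → ℕ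
owed P? k = if does P? then k ∸ 1 else k

owed-sound : ∀ {a w} (2? : Dec (a ≡ 2)) k → owed 2? k ≤ twos w → k ≤ twos (a ∷ w)
owed-sound (yes refl) zero    p = z≤n
owed-sound (yes refl) (suc k) p = s≤s p
owed-sound (no a≢2)   k       p = subst (k ≤_) (cong length (sym (filter-reject (_≟ 2) a≢2))) p

owed-complete : ∀ {a w} (2? : Dec (a ≡ 2)) k → k ≤ twos (a ∷ w) → owed 2? k ≤ twos w
owed-complete (yes refl) zero    p       = z≤n
owed-complete (yes refl) (suc k) (s≤s p) = p
owed-complete (no a≢2)   k       p       = subst (k ≤_) (cong length (filter-reject (_≟ 2) a≢2)) p

_≟ᴵ_ : DecidableEquality Item
_≟ᴵ_ = ×-≟ _≟_ _≟ᴱ_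

derive : ℕ → Item → List Item
derive a (k , e) = map (owed (a ≟ 2) k ,_) (pderiv a e)

advance : ℕ → List Item → List Item
advance a = deduplicate _≟ᴵ_ ∘ concatMap (derive a)

advance-sound : ∀ {a w} is → Any (Matches w) (advance a is) → Any (Matches (a ∷ w)) is
advance-sound {a} is p with find p
... | i , i∈ , m = Any.map item (Any.concatMap⁻ (derive a) (lose (∈-deduplicate⁻ _≟ᴵ_ _ i∈) m))
  where
  item : ∀ {i w} → Any (Matches w) (derive a i) → Matches (a ∷ w) i
  item {k , e} q with find (Any.map⁻ q)
  ... | d , d∈ , k≤ , w∈d = owed-sound (a ≟ 2) k k≤ , pderiv-sound e (lose d∈ w∈d)

advance-complete : ∀ {a w} is → Any (Matches (a ∷ w)) is → Any (Matches w) (advance a is)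
advance-complete {a} is p with find (Any.concatMap⁺ (derive a) (Any.map item p))
  where
  item : ∀ {i w} → Matches (a ∷ w) i → Any (Matches w) (derive a i)
  item {k , e} (k≤ , aw∈e) = Any.map⁺ (Any.map (owed-complete (a ≟ 2) k k≤ ,_) (pderiv-complete e aw∈e refl))
... | i , i∈ , m = lose (∈-deduplicate⁺ _≟ᴵ_ i∈) m

-- The left quotient of a finite language by a letter, the counterpart of `advance` for the
-- exceptional words.
residual : ℕ → List Word → List Word
residual a []             = []
residual a ([] ∷ ws)      = residual a ws
residual a ((b ∷ w) ∷ ws) = guard (a ≟ b) (w ∷ []) ++ residual a ws

residual-sound : ∀ {a w} ws → w ∈ˡ residual a ws → (a ∷ w) ∈ˡ ws
residual-sound ([] ∷ ws) p = there (residual-sound ws p)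
residual-sound {a} ((b ∷ v) ∷ ws) p with ∈-++⁻ (guard (a ≟ b) (v ∷ [])) p
... | inj₂ q = there (residual-sound ws q)
... | inj₁ q with guard⁻ (a ≟ b) q
...   | refl , here refl = here refl

residual-complete : ∀ {a w} ws → (a ∷ w) ∈ˡ ws → w ∈ˡ residual a ws
residual-complete ([] ∷ ws) (there p) = residual-complete ws p
residual-complete {a} ((b ∷ v) ∷ ws) (here refl) = ∈-++⁺ˡ (guard⁺ (a ≟ a) refl (here refl))
residual-complete {a} ((b ∷ v) ∷ ws) (there p) = ∈-++⁺ʳ (guard (a ≟ b) (v ∷ [])) (residual-complete ws p)

families : List Item
families =
    (0 , `0 ∙ (`1 ∙ `2) ∙ (`1 ∙ `2) +)
  ∷ (0 , ((`0 ∣ `1) ∙ `2) + ∣ `2 ∙ ((`0 ∣ `1) ∙ `2) +)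
  ∷ (0 , ((`1 ∣ `2) ∙ `0) + ∙ `2 ∣ `0 ∙ ((`1 ∣ `2) ∙ `0) + ∙ `2)
  ∷ (2 , ((`1 ∣ `2) ∙ `0) + ∙ `1 ∙ `2 ∣ (`0 ∙ (`1 ∣ `2)) + ∙ `0 ∙ `1 ∙ `2)
  ∷ (0 , (`0 ∙ `1) ⋆ ∙ `0 ∙ `2 ∙ `1 ∙ `2 ∣ (`1 ∙ `0) + ∙ `2 ∙ `1 ∙ `2)
  ∷ (0 , `1 ∙ (`2 ∙ `0) + ∙ `1 ∙ (`2 ∙ `0) ⋆ ∙ `2 ∣ `0 ∙ (`2 ∙ `1) + ∙ `0 ∙ (`2 ∙ `1) ⋆ ∙ `2)
  ∷ (0 , `1 ∙ (`0 ∙ `2) + ∙ `1 ∙ (`0 ∙ `2) +)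
  ∷ (0 , `1 ∙ (`0 ∙ `2) + ∙ `1 ∙ `2)
  ∷ []

-- Correctness of the automaton

-- After reading v: the state of v, then items and words that together describe
-- the words w for which v w is bad.
Snapshot : Set
Snapshot = ℕ × List Item × List Word

_≟ˢ_ : DecidableEquality Snapshot
_≟ˢ_ = ×-≟ _≟_ (×-≟ (List.≡-dec _≟ᴵ_) (List.≡-dec (List.≡-dec _≟_)))

origin : Snapshot
origin = 1 , families , exceptional

move : Snapshot → ℕ → Snapshot
move (q , is , ws) a = δ q a , advance a is , residual a ws

Contains : Snapshot → Word → Set
Contains (q , is , ws) w = Any (Matches w) is ⊎ w ∈ˡ ws

contains[]? : ∀ x → Dec (Contains x [])
contains[]? (q , is , ws) =
  Any.any? (λ (k , e) → k ≤? 0 ×-dec []∈? e) is ⊎-dec DecMembership._∈?_ (List.≡-dec _≟_) [] ws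

Consistent : Snapshot → Set
Consistent x@(q , _) = (Contains x [] → Accepting q) × (Accepting q → Contains x [])

consistent? : ∀ x → Dec (Consistent x)
consistent? x@(q , _) = (contains[]? x →-dec accepting? q) ×-dec (accepting? q →-dec contains[]? x)

module Snapshots = Exploration _≟ˢ_ (origin ∷ []) (λ x → map (move x) letters) consistent?

snapshots-invariant : Snapshots.Invariant Snapshots.states
snapshots-invariant = witness (Snapshots.invariant? Snapshots.states) refl

-- Induction on `w`: a letter leads to another snapshot of the closed set, and derivatives preserve
-- containment, so everything reduces to the empty word, where agreement has been checked. This
-- certifies the table `row` on words over `letters`.
recognised : ∀ {xs} → Snapshots.Invariant xs → ∀ {x} w → Letters w → x ∈ˡ xs →
             let q = proj₁ x in
             (Contains x w → Accepting (run q w)) × (Accepting (run q w) → Contains x w)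
recognised (_ , _ , ok) [] [] x∈ = All.lookup ok x∈
recognised inv@(_ , closed , _) {x@(_ , is , ws)} (a ∷ w) (a∈ ∷ w∈) x∈
  with recognised inv w w∈ (All.lookup (All.lookup closed x∈) (∈-map⁺ (move x) a∈))
... | f , g = f ∘ Sum.map (advance-complete is) (residual-complete ws)
            , Sum.map (advance-sound is) (residual-sound ws) ∘ g

bad⇒contains : ∀ {s} → Bad s → Contains origin s
bad⇒contains (I p)    = inj₁ (here (z≤n , p))
bad⇒contains (II p)   = inj₁ (there (here (z≤n , p)))
bad⇒contains (III p)  = inj₁ (there (there (here (z≤n , p))))
bad⇒contains (IV p k) = inj₁ (there (there (there (here (k , p)))))
bad⇒contains (V p)    = inj₁ (there (there (there (there (here (z≤n , p))))))
bad⇒contains (VI p)   = inj₁ (there (there (there (there (there (here (z≤n , p)))))))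
bad⇒contains (VII p)  = inj₁ (there (there (there (there (there (there (here (z≤n , p))))))))
bad⇒contains (VIII p) = inj₁ (there (there (there (there (there (there (there (here (z≤n , p)))))))))
bad⇒contains (IX p)   = inj₂ p

contains⇒bad : ∀ {s} → Contains origin s → Bad s
contains⇒bad (inj₁ (here (_ , p))) = I p
contains⇒bad (inj₁ (there (here (_ , p)))) = II p
contains⇒bad (inj₁ (there (there (here (_ , p))))) = III p
contains⇒bad (inj₁ (there (there (there (here (k , p)))))) = IV p k
contains⇒bad (inj₁ (there (there (there (there (here (_ , p))))))) = V p
contains⇒bad (inj₁ (there (there (there (there (there (here (_ , p)))))))) = VI p
contains⇒bad (inj₁ (there (there (there (there (there (there (here (_ , p))))))))) = VII p
contains⇒bad (inj₁ (there (there (there (there (there (there (there (here (_ , p)))))))))) = VIII p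
contains⇒bad (inj₂ p) = IX p

recognised-origin : ∀ w → Letters w →
                    (Contains origin w → Accepted w) × (Accepted w → Contains origin w)
recognised-origin w w∈ = recognised snapshots-invariant w w∈ (All.head (proj₁ snapshots-invariant))

bad⇒accepted : ∀ {s} → Letters s → Bad s → Accepted s
bad⇒accepted s∈ = proj₁ (recognised-origin _ s∈) ∘ bad⇒contains

accepted⇒bad : ∀ {s} → Letters s → Accepted s → Bad s
accepted⇒bad s∈ = contains⇒bad ∘ proj₂ (recognised-origin _ s∈)

-- Shortening flips

-- Having read u, with first letter c, the machine knows: the state of u, the last
-- letter of u, the state of u with its first two letters exchanged, a countdown
-- that reaches 0 when u has length 6, the states of the words obtained from u by
-- shortening flips, and the table q ↦ run q (reverse u).
record State : Set where
  constructor ⟨_,_,_,_,_,_⟩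
  field
    current  : ℕ
    previous : ℕ
    swapped  : ℕ
    pending  : ℕ
    reduced  : List ℕ
    reversed : List ℕ

open State

_≟ₛ_ : DecidableEquality State
⟨ q , a , t , k , S , f ⟩ ≟ₛ ⟨ q′ , a′ , t′ , k′ , S′ , f′ ⟩ =
  map′ (λ { (refl , refl , refl , refl , refl , refl) → refl })
       (λ { refl → refl , refl , refl , refl , refl , refl })
       (q ≟ q′ ×-dec a ≟ a′ ×-dec t ≟ t′ ×-dec k ≟ k′
        ×-dec List.≡-dec _≟_ S S′ ×-dec List.≡-dec _≟_ f f′)

nth-map : ∀ {f : ℕ → ℕ} → f 0 ≡ 0 → ∀ xs n → nth (map f xs) n ≡ f (nth xs n)
nth-map f0 []       n       = sym f0
nth-map f0 (x ∷ xs) zero    = refl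
nth-map f0 (x ∷ xs) (suc n) = nth-map f0 xs n

δ-sink : ∀ a → δ 0 a ≡ 0
δ-sink 0 = refl
δ-sink 1 = refl
δ-sink 2 = refl
δ-sink (suc (suc (suc _))) = refl

run-sink : ∀ w → run 0 w ≡ 0
run-sink []      = refl
run-sink (a ∷ w) = trans (cong (λ q → run q w) (δ-sink a)) (run-sink w)

run-++ : ∀ q v w → run q (v ++ w) ≡ run (run q v) w
run-++ q []      w = refl
run-++ q (a ∷ v) w = run-++ (δ q a) v w

Tabulates : List ℕ → Word → Set
Tabulates f v = ∀ q → nth f q ≡ run q v

-- A newly read letter comes first in the reversed prefix, so the old table is precomposed with
-- `row a`. Beyond the end of the row both sides are the sink.
tabulates-∷ : ∀ f v a → Tabulates f v → Tabulates (map (nth f) (row a)) (a ∷ v)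
tabulates-∷ f v a f≗v q =
  trans (nth-map (trans (f≗v 0) (run-sink v)) (row a) q) (f≗v (δ q a))

module _ (c : ℕ) where

  -- In use, `v` is the reversal of the prefix read so far and thus ends in its first letter `c`.
  -- Flipping that prefix just before another `c` merges the two copies, which leaves `v ++ w`.
  reducts : Word → Word → List Word
  reducts v []      = []
  reducts v (a ∷ w) = guard (a ≟ c) ((v ++ w) ∷ []) ++ reducts (a ∷ v) w

  reducts-complete : ∀ v x w → (x ʳ++ (v ++ w)) ∈ˡ reducts v (x ++ c ∷ w)
  reducts-complete v []      w = ∈-++⁺ˡ (guard⁺ (c ≟ c) refl (here refl))
  reducts-complete v (a ∷ x) w = ∈-++⁺ʳ (guard (a ≟ c) _) (reducts-complete (a ∷ v) x w)

  reducts-sound : ∀ v u {t} → t ∈ˡ reducts v u →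
                  ∃[ x ] ∃[ w ] (u ≡ x ++ c ∷ w × t ≡ x ʳ++ (v ++ w))
  reducts-sound v (a ∷ u) t∈ with ∈-++⁻ (guard (a ≟ c) ((v ++ u) ∷ [])) t∈
  ... | inj₂ t∈′ with reducts-sound (a ∷ v) u t∈′
  ...   | x , w , refl , refl = a ∷ x , w , refl , refl
  reducts-sound v (a ∷ u) t∈ | inj₁ t∈′ with guard⁻ (a ≟ c) t∈′
  ...   | refl , here refl = [] , u , refl , refl

  next : State → ℕ → State
  next ⟨ q , _ , t , k , S , f ⟩ a =
    ⟨ δ q a , a , δ t a , k ∸ 1
    -- `nth f 1` is the state of the reversed prefix before `a` is read: this is the reduct born
    -- here if `a` equals `c`.
    , deduplicate _≟_ (guard (a ≟ c) (nth f 1 ∷ []) ++ map (λ s → δ s a) S)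
    , map (nth f) (row a) ⟩

  start : ℕ → State
  -- Two letters have been read, so four more are missing until length 6. No reduct exists yet,
  -- since `d` differs from `c`.
  start d = ⟨ run 1 (c ∷ d ∷ []) , d , run 1 (d ∷ c ∷ []) , 4 , [] , map (nth (row c)) (row d) ⟩

  others : ℕ → List ℕ
  others a = filter (λ b → ¬? (a ≟ b)) letters

  successors : State → List State
  successors x = map (next x) (others (previous x))

  starts : List State
  starts = map start (others c)

  -- The conjuncts are (A), (B) and (C) for the word read. (A) is required at every length, the
  -- other two only once the countdown has ended.
  Optimal : State → Set
  Optimal ⟨ q , a , t , k , S , _ ⟩ =
    (Accepting q → All Accepting S) ×
    (k ≡ 0 → (¬ Accepting q → a ≡ 2 → Any (¬_ ∘ Accepting) S) ×
             (Accepting q → S ≡ [] → ¬ Accepting t))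

  optimal? : ∀ x → Dec (Optimal x)
  optimal? ⟨ q , a , t , k , S , _ ⟩ =
    (accepting? q →-dec All.all? accepting? S) ×-dec
    ((k ≟ 0) →-dec
      ((¬? (accepting? q) →-dec ((a ≟ 2) →-dec Any.any? (¬? ∘ accepting?) S)) ×-dec
       (accepting? q →-dec (List.≡-dec _≟_ S [] →-dec ¬? (accepting? t)))))

  module States = Exploration _≟ₛ_ starts successors optimal?

  follow : State → Word → State
  follow = foldl next

  follow-∈ : ∀ {xs} → States.Invariant xs → ∀ {x} w → x ∈ˡ xs →
             Normalized (previous x ∷ w) → Letters w → follow x w ∈ˡ xs
  follow-∈ inv [] x∈ _ _ = x∈
  follow-∈ inv@(_ , closed , _) {x} (a ∷ w) x∈ (≢a ∷ norm) (a∈ ∷ w∈) =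
    follow-∈ inv w
      (All.lookup (All.lookup closed x∈)
        (∈-map⁺ (next x) (∈-filter⁺ (λ b → ¬? (previous x ≟ b)) a∈ ≢a)))
      norm w∈

  follow-current : ∀ x w → current (follow x w) ≡ run (current x) w
  follow-current x []      = refl
  follow-current x (a ∷ w) = follow-current (next x a) w

  follow-swapped : ∀ x w → swapped (follow x w) ≡ run (swapped x) w
  follow-swapped x []      = refl
  follow-swapped x (a ∷ w) = follow-swapped (next x a) w

  follow-pending : ∀ x w → pending (follow x w) ≡ pending x ∸ length w
  follow-pending x []      = refl
  follow-pending x (a ∷ w) = trans (follow-pending (next x a) w) (∸-+-assoc (pending x) 1 (length w))

  follow-previous : ∀ x w → last (previous x ∷ w) ≡ just (previous (follow x w))
  follow-previous x []      = refl
  follow-previous x (a ∷ w) = follow-previous (next x a) w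

  follow-reduced : ∀ {s} x w → s ∈ˡ reduced x → run s w ∈ˡ reduced (follow x w)
  follow-reduced x []      s∈ = s∈
  follow-reduced x (a ∷ w) s∈ = follow-reduced (next x a) w
    (∈-deduplicate⁺ _≟_ (∈-++⁺ʳ (guard (a ≟ c) _) (∈-map⁺ (λ s → δ s a) s∈)))

  -- A reduct enters the set as the state of its reversed prefix and is then carried along by the
  -- letters that follow.
  reducts⇒reduced : ∀ {t v} x w → Tabulates (reversed x) v → t ∈ˡ reducts v w →
                    run 1 t ∈ˡ reduced (follow x w)
  reducts⇒reduced {t} {v} x (a ∷ w) f≗v t∈ with ∈-++⁻ (guard (a ≟ c) ((v ++ w) ∷ [])) t∈
  ... | inj₂ t∈′ = reducts⇒reduced (next x a) w (tabulates-∷ (reversed x) v a f≗v) t∈′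
  ... | inj₁ t∈′ with guard⁻ (a ≟ c) t∈′
  ...   | refl , here refl =
    subst (_∈ˡ reduced (follow (next x a) w))
          (trans (cong (λ q → run q w) (f≗v 1)) (sym (run-++ 1 v w)))
          (follow-reduced (next x a) w
            (∈-deduplicate⁺ _≟_ (∈-++⁺ˡ (guard⁺ (a ≟ c) refl (here refl)))))

  -- The converse, which turns a state found in the set back into an actual shortening flip.
  reduced⇒reducts : ∀ {s v} x w → Tabulates (reversed x) v → s ∈ˡ reduced (follow x w) →
                    (∃[ r ] (r ∈ˡ reduced x × s ≡ run r w)) ⊎ (∃[ t ] (t ∈ˡ reducts v w × s ≡ run 1 t))
  reduced⇒reducts x [] f≗v s∈ = inj₁ (_ , s∈ , refl)
  reduced⇒reducts {v = v} x (a ∷ w) f≗v s∈ with reduced⇒reducts (next x a) w (tabulates-∷ (reversed x) v a f≗v) s∈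
  ... | inj₂ (t , t∈ , eq) = inj₂ (t , ∈-++⁺ʳ (guard (a ≟ c) _) t∈ , eq)
  ... | inj₁ (r , r∈ , eq)
    with ∈-++⁻ (guard (a ≟ c) (nth (reversed x) 1 ∷ [])) (∈-deduplicate⁻ _≟_ _ r∈)
  ...   | inj₂ r∈′ with ∈-map⁻ (λ s → δ s a) r∈′
  ...     | p , p∈ , refl = inj₁ (p , p∈ , eq)
  reduced⇒reducts {v = v} x (a ∷ w) f≗v s∈ | inj₁ (r , r∈ , eq) | inj₁ r∈′ with guard⁻ (a ≟ c) r∈′
  ...     | a≡c , here refl =
    inj₂ (v ++ w , ∈-++⁺ˡ (guard⁺ (a ≟ c) a≡c (here refl)) ,
          trans eq (trans (cong (λ q → run q w) (f≗v 1)) (sym (run-++ 1 v w))))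

  module _ {xs} (inv : States.Invariant xs) {d r}
           (norm : Normalized (c ∷ d ∷ r)) (d∈ : d ∈ˡ letters) (r∈ : Letters r) where

    private
      end : State
      end = follow (start d) r

      end-optimal : Optimal end
      end-optimal = All.lookup (proj₂ (proj₂ inv))
        (follow-∈ inv r
          (All.lookup (proj₁ inv) (∈-map⁺ start (∈-filter⁺ (λ b → ¬? (c ≟ b)) d∈ (Linked.head norm))))
          (Linked.tail norm) r∈)

      tabulated : Tabulates (reversed (start d)) (d ∷ c ∷ [])
      tabulated = tabulates-∷ (row c) (c ∷ []) d (λ q → refl)

      end-pending : 4 ≤ length r → pending end ≡ 0
      end-pending 4≤ = trans (follow-pending (start d) r) (m≤n⇒m∸n≡0 4≤)

      reduct : ∀ {s} → s ∈ˡ reduced end → ∃[ t ] (t ∈ˡ reducts (d ∷ c ∷ []) r × s ≡ run 1 t)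
      reduct s∈ with reduced⇒reducts (start d) r tabulated s∈
      -- The other alternative is void because `reduced (start d)` is empty.
      ... | inj₂ p = p

    reducts-accepted : Accepted (c ∷ d ∷ r) → All Accepted (reducts (d ∷ c ∷ []) r)
    reducts-accepted acc = All.tabulate λ t∈ →
      All.lookup (proj₁ end-optimal (subst Accepting (sym (follow-current (start d) r)) acc))
                 (reducts⇒reduced (start d) r tabulated t∈)

    rejected-reduct : 4 ≤ length r → last (d ∷ r) ≡ just 2 → ¬ Accepted (c ∷ d ∷ r) →
                      ∃[ t ] (t ∈ˡ reducts (d ∷ c ∷ []) r × ¬ Accepted t)
    rejected-reduct 4≤ ends rej
      with find (proj₁ (proj₂ end-optimal (end-pending 4≤))
                  (rej ∘ subst Accepting (follow-current (start d) r))
                  (just-injective (trans (sym (follow-previous (start d) r)) ends)))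
    ... | s , s∈ , ¬acc with reduct s∈
    ...   | t , t∈ , refl = t , t∈ , ¬acc

    reduct-or-swap : 4 ≤ length r → Accepted (c ∷ d ∷ r) →
                     (∃[ t ] t ∈ˡ reducts (d ∷ c ∷ []) r) ⊎ ¬ Accepted (d ∷ c ∷ r)
    reduct-or-swap 4≤ acc with reduced end in eq
    ... | s ∷ _ with reduct (subst (s ∈ˡ_) (sym eq) (here refl))
    ...   | t , t∈ , _ = inj₁ (t , t∈)
    reduct-or-swap 4≤ acc | [] = inj₂
      (proj₂ (proj₂ end-optimal (end-pending 4≤)) (subst Accepting (sym (follow-current (start d) r)) acc) eq
       ∘ subst Accepting (sym (follow-swapped (start d) r)))

-- The machine depends on the first letter, since a flip shortens exactly when it ends before
-- another copy of it. Evaluating these three searches establishes (A), (B) and (C).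
states-invariant : ∀ {c} → c ∈ˡ letters → ∃[ xs ] States.Invariant c xs
states-invariant (here refl) = _ , witness (States.invariant? 0 (States.states 0)) refl
states-invariant (there (here refl)) = _ , witness (States.invariant? 1 (States.states 1)) refl
states-invariant (there (there (here refl))) = _ , witness (States.invariant? 2 (States.states 2)) refl

-- Flips of normalized words

module _ {A : Set} where

  ʳ++-++-assoc : ∀ (x : List A) {u v} → (x ʳ++ u) ++ v ≡ x ʳ++ (u ++ v)
  ʳ++-++-assoc []      = refl
  ʳ++-++-assoc (a ∷ x) = ʳ++-++-assoc x

  last-++ : ∀ (x : List A) {e w} → last (x ++ e ∷ w) ≡ last (e ∷ w)
  last-++ []          = refl
  last-++ (_ ∷ [])    = refl
  last-++ (_ ∷ b ∷ x) = last-++ (b ∷ x)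

  last-ʳ++ : ∀ (x y : List A) {e w} → last (x ʳ++ (y ++ e ∷ w)) ≡ last (e ∷ w)
  last-ʳ++ []      y = last-++ y
  last-ʳ++ (a ∷ x) y = last-ʳ++ x (a ∷ y)

  take-length : ∀ (x : List A) {w} → take (length x) (x ++ w) ≡ x
  take-length []      = refl
  take-length (a ∷ x) = cong (a ∷_) (take-length x)

  drop-length : ∀ (x : List A) {w} → drop (length x) (x ++ w) ≡ w
  drop-length []      = refl
  drop-length (_ ∷ x) = drop-length x

module _ {A : Set} (_≟ₐ_ : DecidableEquality A) where

  private
    collapse : List A → List A
    collapse = derun _≟ₐ_

  derun-≢ : ∀ {a b} w → a ≢ b → collapse (a ∷ b ∷ w) ≡ a ∷ collapse (b ∷ w)
  derun-≢ {a} {b} w a≢b with a ≟ₐ b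
  ... | yes a≡b = contradiction a≡b a≢b
  ... | no _    = refl

  derun-≡ : ∀ a w → collapse (a ∷ a ∷ w) ≡ collapse (a ∷ w)
  derun-≡ a w with a ≟ₐ a
  ... | yes _   = refl
  ... | no a≢a = contradiction refl a≢a

  derun-linked : ∀ {w} → Linked _≢_ w → collapse w ≡ w
  derun-linked []         = refl
  derun-linked [-]        = refl
  derun-linked {a ∷ b ∷ w} (a≢b ∷ l) = trans (derun-≢ w a≢b) (cong (a ∷_) (derun-linked l))

  derun-∷ : ∀ a w → ∃[ v ] collapse (a ∷ w) ≡ a ∷ v
  derun-∷ a []      = _ , refl
  derun-∷ a (b ∷ w) with a ≟ₐ b
  ... | yes refl = derun-∷ a w
  ... | no _     = _ , refl

  linked-derun : ∀ w → Linked _≢_ (collapse w)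
  linked-derun []      = []
  linked-derun (a ∷ []) = [-]
  linked-derun (a ∷ b ∷ w) with a ≟ₐ b | collapse (b ∷ w) | derun-∷ b w | linked-derun (b ∷ w)
  ... | yes _  | _ | _        | l = l
  ... | no a≢b | _ | _ , refl | l = a≢b ∷ l

  last-derun : ∀ w → last (collapse w) ≡ last w
  last-derun []      = refl
  last-derun (a ∷ []) = refl
  last-derun (a ∷ b ∷ w) with a ≟ₐ b | collapse (b ∷ w) | derun-∷ b w | last-derun (b ∷ w)
  ... | yes _ | _ | _        | eq = eq
  ... | no _  | _ | _ , refl | eq = eq

  -- Both tails begin with `b`, so the comparison with `a` has the same outcome on either side.
  derun-cong-∷ : ∀ a b u v → collapse (b ∷ u) ≡ collapse (b ∷ v) →
                 collapse (a ∷ b ∷ u) ≡ collapse (a ∷ b ∷ v)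
  derun-cong-∷ a b u v eq with a ≟ₐ b
  ... | yes _ = eq
  ... | no _  = cong (a ∷_) eq

  derun-cong-ʳ++ : ∀ x b u v → collapse (b ∷ u) ≡ collapse (b ∷ v) →
                   collapse (x ʳ++ (b ∷ u)) ≡ collapse (x ʳ++ (b ∷ v))
  derun-cong-ʳ++ []      b u v eq = eq
  derun-cong-ʳ++ (a ∷ x) b u v eq = derun-cong-ʳ++ x a (b ∷ u) (b ∷ v) (derun-cong-∷ a b u v eq)

  derun-derun-++ : ∀ u v → collapse (collapse u ++ v) ≡ collapse (u ++ v)
  derun-derun-++ []       v = refl
  derun-derun-++ (a ∷ []) v = refl
  derun-derun-++ (a ∷ b ∷ u) v with a ≟ₐ b | collapse (b ∷ u) | derun-∷ b u | derun-derun-++ (b ∷ u) v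
  ... | yes _  | _ | _        | eq = eq
  ... | no a≢b | _ | w , refl | eq = trans (derun-≢ (w ++ v) a≢b) (cong (a ∷_) eq)

normalized-ʳ++ : ∀ {c} x {w} → Normalized (c ∷ x) → Normalized (c ∷ w) → Normalized (x ʳ++ (c ∷ w))
normalized-ʳ++ []      _         n = n
normalized-ʳ++ (d ∷ x) (c≢d ∷ m) n = normalized-ʳ++ x m (≢-sym c≢d ∷ n)

normalized-++⁻ : ∀ {c} x {w} → Normalized (c ∷ x ++ w) → Normalized (c ∷ x) × Normalized w
normalized-++⁻ []      n          = [-] , Linked.tail n
normalized-++⁻ (d ∷ x) (c≢d ∷ n) with normalized-++⁻ x n
... | m , l = c≢d ∷ m , l

normalize-ʳ++-≢ : ∀ {c e} x {w} → Normalized (c ∷ x ++ e ∷ w) → c ≢ e →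
                  normalize (x ʳ++ (c ∷ e ∷ w)) ≡ x ʳ++ (c ∷ e ∷ w)
normalize-ʳ++-≢ x n c≢e with normalized-++⁻ x n
... | m , l = derun-linked _≟_ (normalized-ʳ++ x m (c≢e ∷ l))

normalize-ʳ++-≡ : ∀ {c} x {w} → Normalized (c ∷ x ++ c ∷ w) →
                  normalize (x ʳ++ (c ∷ c ∷ w)) ≡ x ʳ++ (c ∷ w)
normalize-ʳ++-≡ {c} x {w} n with normalized-++⁻ x n
... | m , l = trans (derun-cong-ʳ++ _≟_ x c (c ∷ w) w (derun-≡ _≟_ c w)) (derun-linked _≟_ (normalized-ʳ++ x m l))

flip-prefix : ∀ c x w → flip (suc (length x)) (c ∷ x ++ w) ≡ normalize (x ʳ++ (c ∷ w))
flip-prefix c x w = cong normalize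
  (trans (cong₂ (λ u v → reverse (c ∷ u) ++ v) (take-length x) (drop-length x)) (sym (ʳ++-defn (c ∷ x))))

-- A view of a flip position as a cut of the word; with `flip-prefix` it replaces index arithmetic
-- by accumulating reversal.
data Split : Word → ℕ → Set where
  split : ∀ c x w → Split (c ∷ x ++ w) (suc (length x))

splitAt : ∀ s i → 1 ≤ i → i ≤ length s → Split s i
splitAt (c ∷ s) (suc j) _ (s≤s j≤) =
  subst₂ (λ u k → Split (c ∷ u) (suc k)) (take++drop≡id j s)
         (trans (length-take j s) (m≤n⇒m⊓n≡m j≤))
         (split c (take j s) (drop j s))

-- This is (A) for a single flip. An empty `x` would put two copies of `c` next to each other.
reduct-accepted : ∀ {c} x {w} → Normalized (c ∷ x ++ c ∷ w) → Letters (c ∷ x ++ c ∷ w) →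
                  Accepted (c ∷ x ++ c ∷ w) → Accepted (x ʳ++ (c ∷ w))
reduct-accepted [] (c≢c ∷ _) = contradiction refl c≢c
reduct-accepted {c} (d ∷ x) {w} n (c∈ ∷ d∈ ∷ r∈) acc =
  All.lookup (reducts-accepted c (proj₂ (states-invariant c∈)) n d∈ r∈ acc)
             (reducts-complete c (d ∷ c ∷ []) x w)

-- Either alternative implies that the potential, namely the length plus one for accepted words,
-- drops by at most one from `s` to `t`.
Descends : Word → Word → Set
Descends s t = length s ≤ length t ⊎ (length s ≤ suc (length t) × (Accepted s → Accepted t))

reversal-descends : ∀ c x e w → Normalized (c ∷ x ++ e ∷ w) → Letters (c ∷ x ++ e ∷ w) →
                    Descends (c ∷ x ++ e ∷ w) (normalize (x ʳ++ (c ∷ e ∷ w)))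
reversal-descends c x e w n s∈ with c ≟ e
... | yes refl rewrite normalize-ʳ++-≡ x n =
  inj₂ (≤-reflexive (cong suc (↭-length (++↭ʳ++ x (c ∷ w)))) , reduct-accepted x n s∈)
... | no c≢e rewrite normalize-ʳ++-≢ x n c≢e =
  inj₁ (≤-reflexive (↭-length (++↭ʳ++ (c ∷ x) (e ∷ w))))

-- A flip of s acts on cap s in the same way, except for the flip of all of s
-- when s ends in 2.
cap : Word → Word
cap s = normalize (s ∷ʳ 2)

normalized-∷ʳ2 : ∀ {s} → Normalized s → last s ≢ just 2 → Normalized (s ∷ʳ 2)
normalized-∷ʳ2 []          _  = [-]
normalized-∷ʳ2 [-]         ≢2 = (≢2 ∘ cong just) ∷ [-]
normalized-∷ʳ2 (a≢b ∷ n) ≢2 = a≢b ∷ normalized-∷ʳ2 n ≢2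

cap-≡ : ∀ {s} → Normalized s → last s ≡ just 2 → cap s ≡ s
cap-≡ [-]       refl = refl
cap-≡ {a ∷ b ∷ s} (a≢b ∷ n) ≡2 = trans (derun-≢ _≟_ (s ∷ʳ 2) a≢b) (cong (a ∷_) (cap-≡ n ≡2))

cap-≢ : ∀ {s} → Normalized s → last s ≢ just 2 → cap s ≡ s ∷ʳ 2
cap-≢ n ≢2 = derun-linked _≟_ (normalized-∷ʳ2 n ≢2)

endsIn2? : ∀ s → Dec (last s ≡ just 2)
endsIn2? s = Maybe.≡-dec _≟_ (last s) (just 2)

length-cap : ∀ {s} → Normalized s → length s ≤ length (cap s)
length-cap {s} n with endsIn2? s
... | yes ≡2 rewrite cap-≡ n ≡2 = ≤-refl
... | no ≢2 rewrite cap-≢ n ≢2 | length-++ s {2 ∷ []} = m≤m+n _ _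

-- Normalizing a prefix beforehand does not change the final normal form.
cap-reversal : ∀ x c w → cap (normalize (x ʳ++ (c ∷ w))) ≡ normalize (x ʳ++ (c ∷ w ∷ʳ 2))
cap-reversal x c w = trans (derun-derun-++ _≟_ (x ʳ++ (c ∷ w)) (2 ∷ []))
                           (cong normalize (ʳ++-++-assoc x))

letters-∷ʳ2 : ∀ {s} → Letters s → Letters (s ∷ʳ 2)
letters-∷ʳ2 s∈ = All.∷ʳ⁺ s∈ (there (there (here refl)))

cap-descends : ∀ c x w → Normalized (c ∷ x ++ w) → Letters (c ∷ x ++ w) →
               Descends (cap (c ∷ x ++ w)) (cap (normalize (x ʳ++ (c ∷ w))))
cap-descends c x w n s∈ with endsIn2? (c ∷ x ++ w)
cap-descends c x w n s∈ | no ≢2 rewrite cap-≢ n ≢2 | cap-reversal x c w =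
  subst (λ s → Descends s (normalize (x ʳ++ (c ∷ w ∷ʳ 2)))) (sym assoc)
        (descends w (subst Normalized assoc (normalized-∷ʳ2 n ≢2)) (subst Letters assoc (letters-∷ʳ2 s∈)))
  where
  assoc : (c ∷ x ++ w) ∷ʳ 2 ≡ c ∷ x ++ w ∷ʳ 2
  assoc = ++-assoc (c ∷ x) w (2 ∷ [])
  descends : ∀ w → Normalized (c ∷ x ++ w ∷ʳ 2) → Letters (c ∷ x ++ w ∷ʳ 2) →
             Descends (c ∷ x ++ w ∷ʳ 2) (normalize (x ʳ++ (c ∷ w ∷ʳ 2)))
  -- Even the flip of the whole word leaves the appended 2 in place; that 2 is then the letter next
  -- to `c`.
  descends []      = reversal-descends c x 2 []
  descends (e ∷ w) = reversal-descends c x e (w ∷ʳ 2)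
-- The flip of a whole word ending in 2 moves that 2, but it loses no length, and capping the result
-- cannot shorten it.
cap-descends c x [] n s∈ | yes ≡2 rewrite cap-≡ n ≡2 with normalized-++⁻ x n
... | m , _ = inj₁ (≤-trans (≤-reflexive (↭-length (++↭ʳ++ (c ∷ x) [])))
  (≤-trans (≤-reflexive (cong length (sym (derun-linked _≟_ (normalized-ʳ++ x m [-])))))
           (length-cap (linked-derun _≟_ (x ʳ++ (c ∷ []))))))
cap-descends c x (e ∷ w) n s∈ | yes ≡2 rewrite cap-≡ n ≡2 =
  subst (Descends (c ∷ x ++ e ∷ w))
        (sym (trans (cap-reversal x c (e ∷ w))
          (derun-cong-ʳ++ _≟_ x c (e ∷ w ∷ʳ 2) (e ∷ w) (derun-cong-∷ _≟_ c e (w ∷ʳ 2) w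
            (trans (cap-≡ tail (trans (sym (last-++ (c ∷ x))) ≡2)) (sym (derun-linked _≟_ tail)))))))
        (reversal-descends c x e w n s∈)
  where
  tail : Normalized (e ∷ w)
  tail = proj₂ (normalized-++⁻ x n)

normalize-letters : ∀ {c} x {w} → Letters (c ∷ x ++ w) → Letters (normalize (x ʳ++ (c ∷ w)))
normalize-letters {c} x {w} s∈ = All.derun⁺ _≟_ (All-resp-↭ (++↭ʳ++ (c ∷ x) w) s∈)

∈-normalize : ∀ {a c} x {w} → a ∈ˡ c ∷ x ++ w → a ∈ˡ normalize (x ʳ++ (c ∷ w))
∈-normalize {c = c} x {w} a∈ = ∈-derun⁺ _≟_ (∈-resp-↭ (++↭ʳ++ (c ∷ x) w) a∈)

-- The lower bound

target : Word
target = 0 ∷ 1 ∷ 2 ∷ []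

-- The potential of `cap s` drops by at most one per flip, and it is 3 at `target`, which is
-- rejected.
lower-bound : ∀ {s m} → Normalized s → Letters s → s ↝[ m ] target →
              length (cap s) ≤ 3 + m × (Accepted (cap s) → length (cap s) ≤ 2 + m)
lower-bound n s∈ done = ≤-refl , λ acc → contradiction acc (witness (¬? (accepted? (cap target))) refl)
lower-bound {s} n s∈ (step i 1≤i i≤ p) with splitAt s i 1≤i i≤
... | split c x w rewrite flip-prefix c x w
  with cap-descends c x w n s∈
     | lower-bound (linked-derun _≟_ (x ʳ++ (c ∷ w))) (normalize-letters x s∈) p
-- `2 + suc m` and `3 + m` are the same bound, so a flip that does not shorten may change acceptance
-- freely.
... | inj₁ s≤t       | t≤ , _  = let s≤ = ≤-trans s≤t t≤ in m≤n⇒m≤1+n s≤ , λ _ → s≤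
... | inj₂ (s≤t , f) | t≤ , t≤′ = ≤-trans s≤t (s≤s t≤) , λ acc → ≤-trans s≤t (s≤s (t≤′ (f acc)))

-- Sorting sequences whose flips all leave the last k letters in place.
data Path (k : ℕ) : Word → ℕ → Set where
  done : Path k target 0
  step : ∀ {s m} i → 1 ≤ i → k + i ≤ length s → Path k (flip i s) m → Path k s (suc m)

path? : ∀ k s m → Dec (Path k s m)
path? k s zero = map′ (λ { refl → done }) (λ { done → refl }) (List.≡-dec _≟_ s target)
path? k s (suc m) = map′ to from (Any.any? first? (upTo (suc (length s))))
  where
  First : ℕ → Set
  First i = 1 ≤ i × k + i ≤ length s × Path k (flip i s) m
  first? : ∀ i → Dec (First i)
  first? i = 1 ≤? i ×-dec k + i ≤? length s ×-dec path? k (flip i s) m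
  to : Any First (upTo (suc (length s))) → Path k s (suc m)
  to p = let i , _ , 1≤i , i≤ , q = find p in step i 1≤i i≤ q
  from : Path k s (suc m) → Any First (upTo (suc (length s)))
  from (step i 1≤i i≤ q) = lose (∈-upTo⁺ (s≤s (m+n≤o⇒n≤o k i≤))) (1≤i , i≤ , q)

path⇒↝ : ∀ {k s m} → Path k s m → s ↝[ m ] target
path⇒↝         done               = done
path⇒↝ {k = k} (step i 1≤i i≤ p) = step i 1≤i (m+n≤o⇒n≤o k i≤) (path⇒↝ p)

↝⇒path : ∀ {s m} → s ↝[ m ] target → Path 0 s m
↝⇒path done              = done
↝⇒path (step i 1≤i i≤ p) = step i 1≤i i≤ (↝⇒path p)

-- Each flip of the path spares the last letter, so it is also a flip of `s`. Once the word itself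
-- ends in 2, capping does nothing and the rest of the path applies directly.
path-uncap : ∀ {s m} → Normalized s → 2 ∈ˡ s → Path 1 (cap s) m → s ↝[ m ] target
path-uncap {s} n 2∈ p with endsIn2? s
... | yes ≡2 = path⇒↝ (subst (λ u → Path 1 u _) (cap-≡ n ≡2) p)
... | no ≢2 = open-path refl (subst (λ u → Path 1 u _) (cap-≢ n ≢2) p)
  where
  open-path : ∀ {u m} → u ≡ s ∷ʳ 2 → Path 1 u m → s ↝[ m ] target
  -- Here `s` would be 01, which contains no 2.
  open-path eq done with subst (2 ∈ˡ_) (sym (∷ʳ-injectiveˡ (0 ∷ 1 ∷ []) s eq)) 2∈
  ... | there (there ())
  open-path refl (step i 1≤i i≤ q) with splitAt s i 1≤i (s≤s⁻¹ (≤-trans i≤ (≤-reflexive (trans (length-++ s) (+-comm (length s) 1)))))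
  ... | split c x w = step (suc (length x)) (s≤s z≤n) len
    (subst (λ u → u ↝[ _ ] target) (sym (flip-prefix c x w))
      (path-uncap (linked-derun _≟_ (x ʳ++ (c ∷ w))) (∈-normalize x 2∈)
        (subst (λ u → Path 1 u _)
          (trans (cong (flip (suc (length x))) (++-assoc (c ∷ x) w (2 ∷ [])))
                 (trans (flip-prefix c x (w ∷ʳ 2)) (sym (cap-reversal x c w)))) q)))
    where
    len : suc (length x) ≤ length (c ∷ x ++ w)
    len = s≤s (≤-trans (m≤m+n (length x) (length w)) (≤-reflexive (sym (length-++ x))))

-- Sorting

record Ternary (s : Word) : Set where
  field
    normalized : Normalized s
    ternary    : Letters s
    full       : All (_∈ˡ s) letters
    ends       : last s ≡ just 2

open Ternary

normalize-ternary : ∀ {c e} x {w} → Ternary (c ∷ x ++ e ∷ w) → Ternary (normalize (x ʳ++ (c ∷ e ∷ w)))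
normalize-ternary {c} {e} x {w} T = record
  { normalized = linked-derun _≟_ (x ʳ++ (c ∷ e ∷ w))
  ; ternary    = normalize-letters x (ternary T)
  ; full       = All.map (∈-normalize x) (full T)
  ; ends       = trans (last-derun _≟_ (x ʳ++ (c ∷ e ∷ w)))
                   (trans (last-ʳ++ x (c ∷ [])) (trans (sym (last-++ (c ∷ x))) (ends T)))
  }

path-normalize : ∀ {m c e} x {w} → Path 1 (normalize (x ʳ++ (c ∷ e ∷ w))) m →
                 Path 1 (c ∷ x ++ e ∷ w) (suc m)
path-normalize {m} {c} {e} x {w} p =
  step (suc (length x)) (s≤s z≤n) (s≤s len)
       (subst (λ t → Path 1 t m) (sym (flip-prefix c x (e ∷ w))) p)
  where
  len : suc (length x) ≤ length (x ++ e ∷ w)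
  len = ≤-trans (≤-reflexive (+-comm 1 (length x)))
          (≤-trans (+-monoʳ-≤ (length x) (s≤s z≤n)) (≤-reflexive (sym (length-++ x))))

-- Words of length at most 5

words : ℕ → List Word
words zero    = [] ∷ []
words (suc n) = cartesianProductWith _∷_ letters (words n)

∈-words : ∀ {s} → Letters s → s ∈ˡ words (length s)
∈-words []         = here refl
∈-words (a∈ ∷ s∈) = ∈-cartesianProductWith⁺ _∷_ a∈ (∈-words s∈)

outlier : Word
outlier = 0 ∷ 2 ∷ 1 ∷ 2 ∷ []

outlier? : ∀ s → Dec (s ≡ outlier)
outlier? s = List.≡-dec _≟_ s outlier

-- The paths fix the last letter, so that `path-uncap` can transfer them to words not ending in 2.
Sortable : ℕ → Word → Set
Sortable n s = (¬ Accepted s → Path 1 s (n ∸ 3)) ×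
               (Accepted s → s ≢ outlier → Path 1 s (n ∸ 2))

SortableIfTernary : ℕ → Word → Set
SortableIfTernary n s = Normalized s → All (_∈ˡ s) letters → last s ≡ just 2 → Sortable n s

-- The cheap conditions come first, so that paths are searched only for words that meet them.
sortableIfTernary? : ∀ n s → Dec (SortableIfTernary n s)
sortableIfTernary? n s =
  linked? (λ a b → ¬? (a ≟ b)) s →-dec All.all? (_∈ˡ? s) letters →-dec endsIn2? s →-dec
  ((¬? (accepted? s) →-dec path? 1 s (n ∸ 3)) ×-dec
   (accepted? s →-dec ¬? (outlier? s) →-dec path? 1 s (n ∸ 2)))

short-sortable : All (λ n → All (SortableIfTernary n) (words n)) (upTo 6)
short-sortable = witness (all? (λ n → all? (sortableIfTernary? n) (words n)) (upTo 6)) refl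

AllSortable : ℕ → Set
AllSortable n = ∀ {s} → length s ≡ n → Ternary s → Sortable n s

sortable-≤5 : ∀ {n} → n < 6 → AllSortable n
sortable-≤5 n<6 {s} refl T =
  All.lookup (All.lookup short-sortable (∈-upTo⁺ n<6)) (∈-words (ternary T))
             (normalized T) (full T) (ends T)

-- Induction on the length

module _ {k} (shorter : AllSortable (5 + k)) where

  via-reduct : ∀ {c} x {w m} → length (c ∷ x ++ c ∷ w) ≡ 6 + k → Ternary (c ∷ x ++ c ∷ w) →
               (Sortable (5 + k) (x ʳ++ (c ∷ w)) → x ʳ++ (c ∷ w) ≢ outlier →
                Path 1 (x ʳ++ (c ∷ w)) m) →
               Path 1 (c ∷ x ++ c ∷ w) (suc m)
  via-reduct {c} x {w} len T f = path-normalize x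
    (subst (λ t → Path 1 t _) (sym eq) (f (shorter len′ (subst Ternary eq (normalize-ternary x T))) ≢outlier))
    where
    eq : normalize (x ʳ++ (c ∷ c ∷ w)) ≡ x ʳ++ (c ∷ w)
    eq = normalize-ʳ++-≡ x (normalized T)
    len′ : length (x ʳ++ (c ∷ w)) ≡ 5 + k
    len′ = trans (sym (↭-length (++↭ʳ++ x (c ∷ w)))) (suc-injective len)
    ≢outlier : x ʳ++ (c ∷ w) ≢ outlier
    ≢outlier eq′ with trans (sym len′) (cong length eq′)
    -- The outlier has length 4, the reduct at least 5.
    ... | ()

  sortable-rejected : ∀ {s} → length s ≡ 6 + k → Ternary s → ¬ Accepted s → Path 1 s (3 + k)
  sortable-rejected {c ∷ d ∷ r} len T rej with ternary T
  ... | c∈ ∷ d∈ ∷ r∈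
    with rejected-reduct c (proj₂ (states-invariant c∈)) (normalized T) d∈ r∈
           (≤-trans (m≤m+n 4 k) (≤-reflexive (sym (suc-injective (suc-injective len))))) (ends T) rej
  ... | t , t∈ , rej-t with reducts-sound c (d ∷ c ∷ []) r t∈
  ... | x , w , refl , refl = via-reduct (d ∷ x) len T λ p _ → proj₁ p rej-t

  -- The exchange costs one flip without shortening, and the good word it yields takes `3 + k` more.
  -- If the third letter equals the first, the same flip shortens, and (A) keeps the reduct bad.
  via-swap : ∀ {c d r} → length (c ∷ d ∷ r) ≡ 6 + k → Ternary (c ∷ d ∷ r) → Accepted (c ∷ d ∷ r) →
             ¬ Accepted (d ∷ c ∷ r) → Path 1 (c ∷ d ∷ r) (4 + k)
  via-swap {c} {d} {e ∷ r} len T acc rej with c ≟ e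
  ... | yes refl = via-reduct (d ∷ []) len T λ p →
    proj₂ p (reduct-accepted (d ∷ []) (normalized T) (ternary T) acc)
  ... | no c≢e = path-normalize (d ∷ []) (subst (λ t → Path 1 t _) (sym eq)
    (sortable-rejected len (subst Ternary eq (normalize-ternary (d ∷ []) T)) rej))
    where
    eq : normalize (d ∷ c ∷ e ∷ r) ≡ d ∷ c ∷ e ∷ r
    eq = normalize-ʳ++-≢ (d ∷ []) (normalized T) c≢e

  sortable-accepted : ∀ {s} → length s ≡ 6 + k → Ternary s → Accepted s → Path 1 s (4 + k)
  sortable-accepted {c ∷ d ∷ r} len T acc with ternary T
  ... | c∈ ∷ d∈ ∷ r∈
    with reduct-or-swap c (proj₂ (states-invariant c∈)) (normalized T) d∈ r∈
           (≤-trans (m≤m+n 4 k) (≤-reflexive (sym (suc-injective (suc-injective len))))) acc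
  ... | inj₂ rej = via-swap len T acc rej
  ... | inj₁ (t , t∈) with reducts-sound c (d ∷ c ∷ []) r t∈
  ...   | x , w , refl , _ = via-reduct (d ∷ x) len T λ p →
    proj₂ p (reduct-accepted (d ∷ x) (normalized T) (ternary T) acc)

-- The base is length 5, because words of length 6 are sorted through their reducts.
sortable-≥5 : ∀ k → AllSortable (5 + k)
sortable-≥5 zero = sortable-≤5 ≤-refl
sortable-≥5 (suc k) len T =
  sortable-rejected (sortable-≥5 k) len T , λ acc _ → sortable-accepted (sortable-≥5 k) len T acc

sortable : ∀ {s} → Ternary s → Sortable (length s) s
sortable {s} T with length s <? 6
... | yes n<6 = sortable-≤5 n<6 refl T
... | no n≮6 with m≤n⇒∃[o]m+o≡n (≤-trans (n≤1+n 5) (≮⇒≥ n≮6))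
...   | k , eq = subst (λ n → Sortable n s) eq (sortable-≥5 k (sym eq) T)

-- The sorting distances

distance : ∀ {s} d → does (path? 0 s d) ≡ true → does (all? (λ m → ¬? (path? 0 s m)) (upTo d)) ≡ true →
           SortingDistance s d
distance {s} d attained minimal = record
  { attained = path⇒↝ (witness (path? 0 s d) attained)
  ; minimal  = λ p → ≮⇒≥ λ m<d →
      All.lookup (witness (all? (λ m → ¬? (path? 0 s m)) (upTo d)) minimal) (∈-upTo⁺ m<d) (↝⇒path p)
  }

fully⇒letters : ∀ {s} → Fully 3 -ary s → Letters s
fully⇒letters fully = All.tabulate λ a∈ → letter (Equivalence.to (fully _) a∈)
  where
  letter : ∀ {a} → a < 3 → a ∈ˡ letters
  letter {0} _ = here refl
  letter {1} _ = there (here refl)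
  letter {2} _ = there (there (here refl))
  letter {suc (suc (suc _))} (s≤s (s≤s (s≤s ())))

fully⇒full : ∀ {s} → Fully 3 -ary s → All (_∈ˡ s) letters
fully⇒full fully = in-s 0 (s≤s z≤n) ∷ in-s 1 (s≤s (s≤s z≤n)) ∷ in-s 2 ≤-refl ∷ []
  where
  in-s : ∀ a → a < 3 → a ∈ˡ _
  in-s a = Equivalence.from (fully a)

-- Upper and lower bound are both expressed through `cap s` and meet there, so the distance depends
-- on `cap s` alone.
capped-distance : ∀ {s} → Normalized s → Letters s → 2 ∈ˡ s → Ternary (cap s) →
                  (¬ Accepted (cap s) → SortingDistance s (length (cap s) ∸ 3)) ×
                  (Accepted (cap s) → cap s ≢ outlier → SortingDistance s (length (cap s) ∸ 2))
capped-distance n s∈ 2∈ T =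
    (λ rej → record
      { attained = path-uncap n 2∈ (proj₁ (sortable T) rej)
      ; minimal  = λ p → m≤n+o⇒m∸n≤o _ 3 (proj₁ (lower-bound n s∈ p)) })
  , (λ acc ≢outlier → record
      { attained = path-uncap n 2∈ (proj₂ (sortable T) acc ≢outlier)
      ; minimal  = λ p → m≤n+o⇒m∸n≤o _ 2 (proj₂ (lower-bound n s∈ p) acc) })

distance-ending-in-2 : ∀ s → Normalized s → Fully 3 -ary s → last s ≡ just 2 → s ≢ outlier →
                       (Bad s → SortingDistance s (length s ∸ 2)) ×
                       (Good s → SortingDistance s (length s ∸ 3))
distance-ending-in-2 s n fully ≡2 ≢outlier =
    (λ bad → subst (λ t → SortingDistance s (length t ∸ 2)) capped
      (proj₂ distances (subst Accepted (sym capped) (bad⇒accepted s∈ bad)) (≢outlier ∘ trans (sym capped))))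
  , (λ good → subst (λ t → SortingDistance s (length t ∸ 3)) capped
      (proj₁ distances (good ∘ accepted⇒bad s∈ ∘ subst Accepted capped)))
  where
  s∈ = fully⇒letters fully
  capped : cap s ≡ s
  capped = cap-≡ n ≡2
  T : Ternary s
  T = record { normalized = n ; ternary = s∈ ; full = fully⇒full fully ; ends = ≡2 }
  distances = capped-distance n s∈ (All.lookup (full T) (there (there (here refl))))
                (subst Ternary (sym capped) T)

-- Capping is idempotent, so `s` and `s ∷ʳ 2` have the same cap and hence the same distance.
distance-∷ʳ2 : ∀ s → Normalized s → Fully 3 -ary s → last s ≢ just 2 →
               ∃[ d ] (SortingDistance s d × SortingDistance (s ∷ʳ 2) d)
distance-∷ʳ2 s n fully ≢2 with outlier? (s ∷ʳ 2)
-- Only 021 becomes the outlier when 2 is appended; exhaustive search gives distance 3 for both.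
... | yes eq rewrite ∷ʳ-injectiveˡ s (0 ∷ 2 ∷ 1 ∷ []) eq = 3 , distance 3 refl refl , distance 3 refl refl
... | no ≢outlier = by-recognition (accepted? (cap s))
  where
  capped : cap s ≡ s ∷ʳ 2
  capped = cap-≢ n ≢2
  s∈ = fully⇒letters fully
  T : Ternary (s ∷ʳ 2)
  T = record
    { normalized = normalized-∷ʳ2 n ≢2
    ; ternary    = letters-∷ʳ2 s∈
    ; full       = All.map ∈-++⁺ˡ (fully⇒full fully)
    ; ends       = last-++ s
    }
  idempotent : cap (s ∷ʳ 2) ≡ cap s
  idempotent = trans (cap-≡ (normalized T) (ends T)) (sym capped)
  2∈ : 2 ∈ˡ s
  2∈ = All.lookup (fully⇒full fully) (there (there (here refl)))
  Tcap : Ternary (cap s)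
  Tcap = subst Ternary (sym capped) T
  distances = capped-distance n s∈ 2∈ Tcap
  distances′ = subst
    (λ t → (¬ Accepted t → SortingDistance (s ∷ʳ 2) (length t ∸ 3)) ×
           (Accepted t → t ≢ outlier → SortingDistance (s ∷ʳ 2) (length t ∸ 2)))
    idempotent
    (capped-distance (normalized T) (ternary T) (∈-++⁺ˡ 2∈) (subst Ternary (sym idempotent) Tcap))
  by-recognition : Dec (Accepted (cap s)) → ∃[ d ] (SortingDistance s d × SortingDistance (s ∷ʳ 2) d)
  by-recognition (yes acc) = _ , proj₂ distances acc ≢cap , proj₂ distances′ acc ≢cap
    where
    ≢cap : cap s ≢ outlier
    ≢cap = ≢outlier ∘ trans (sym capped)
  by-recognition (no rej) = _ , proj₁ distances rej , proj₁ distances′ rej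

theorem4p4 : SortingDistance (0 ∷ 2 ∷ 1 ∷ 2 ∷ []) 3
    × (∀ (s : Word) → Normalized s → Fully 3 -ary s → last s ≡ just 2 →
    s ≢ 0 ∷ 2 ∷ 1 ∷ 2 ∷ [] →
    (Bad s → SortingDistance s (length s ∸ 2))
    × (Good s → SortingDistance s (length s ∸ 3)))
    × (∀ (s : Word) → Normalized s → Fully 3 -ary s →
    last s ≡ just 0 ⊎ last s ≡ just 1 →
    ∃[ d ] (SortingDistance s d × SortingDistance (s ∷ʳ 2) d))
theorem4p4 = distance 3 refl refl , distance-ending-in-2 , λ where
  s n fully (inj₁ ≡0) → distance-∷ʳ2 s n fully λ ≡2 → contradiction (trans (sym ≡0) ≡2) λ ()
  s n fully (inj₂ ≡1) → distance-∷ʳ2 s n fully λ ≡2 → contradiction (trans (sym ≡1) ≡2) λ ()
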